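{- Let $\Sigma$ be a (possibly infinite) unranked signature, $\mathcal{X}$ an infinite set of variables disjoint from $\Sigma$, and $>$ a well-founded partial order on $\Sigma$. Let $\rightsquigarrow$ be the rewrite relation induced by the term rewrite system $\mathit{Star}$ on the trees $\mathbb{T}(\Sigma\cup\Sigma^\star,\mathcal{X})$. Then for no (star-free) tree $t\in\mathbb{T}(\Sigma,\mathcal{X})$ do we have $t\rightsquigarrow^+t$.
   Context: Terms: for an unranked signature $\Gamma$ (a set of symbols without fixed arity) and a set $\mathcal{X}$ of variables disjoint from $\Gamma$, the set of terms $\mathcal{T}(\Gamma,\mathcal{X})$ is the smallest set containing $\mathcal{X}$ and containing $f(t_1,\ldots,t_n)$ for all $f\in\Gamma$, $n\ge 0$ and terms $t_1,\ldots,t_n$. A term rewrite system is a set of rules $\ell\to r$; it induces on terms the rewrite relation $C[\sigma(\ell)]\to C[\sigma(r)]$ for all one-hole contexts $C$, rules $\ell\to r$ and substitutions $\sigma$. Trees: $\simeq$ is the equivalence relation on terms generated by swapping two adjacent arguments of a symbol anywhere inside a term, i.e. generated by the rewrite rules $f(\vec u,x,y,\vec w)\to f(\vec u,y,x,\vec w)$ for all symbols $f$. The set of (unordered) trees is $\mathbb{T}(\Gamma,\mathcal{X})=\mathcal{T}(\Gamma,\mathcal{X})/_{\simeq}$. A rewrite relation $\to$ on terms is extended to trees by: $[s]\to[t]$ whenever $s\to t$, for terms $s,t$ with classes $[s],[t]$. Starred signature: $\Sigma^\star=\{f^\star\mid f\in\Sigma\}$, a set of fresh symbols (disjoint from $\Sigma$).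 The system $\mathit{Star}$ over $\Sigma\cup\Sigma^\star$ consists of the following rules, for all $f,g\in\Sigma$, where $\vec x,\vec y,\vec z$ are finite (possibly empty) vectors of distinct variables: (put) $f(\vec x)\rightsquigarrow f^\star(\vec x)$; (select) $f^\star(\vec x,y,\vec z)\rightsquigarrow y$; (copy) $f^\star(\vec x)\rightsquigarrow g(f^\star(\vec x),\ldots,f^\star(\vec x))$ with $0$ or more copies of $f^\star(\vec x)$, if $f>g$; (down) $f^\star(\vec x,g(\vec y),\vec z)\rightsquigarrow f(\vec x,g^\star(\vec y),\ldots,g^\star(\vec y),\vec z)$ with $0$ or more copies of $g^\star(\vec y)$. -}

module Defs where

open import Level using (Level; _⊔_)
open import Data.Fin.Base using (Fin)
open import Data.List.Base using (List; []; _∷_; _++_; map; replicate)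
open import Data.List.Relation.Unary.Unique.Propositional using (Unique)
open import Data.Product.Base using (∃; ∃₂; _×_)
open import Function.Bundles using (_↔_)
open import Relation.Binary.Core using (Rel)
open import Relation.Binary.Construct.Closure.Equivalence using (EqClosure)
open import Relation.Nullary.Negation.Core using (¬_)

private variable
  a b r : Level
  Γ Δ Sig X : Set a

Infinite : Set a → Set a
Infinite A = ¬ ∃ λ n → Fin n ↔ A

data Term (Γ : Set a) (X : Set b) : Set (a ⊔ b) where
  var  : X → Term Γ X
  node : Γ → List (Term Γ X) → Term Γ X

vars : List X → List (Term Γ X)
vars = map var

mutual
  subst : (X → Term Γ X) → Term Γ X → Term Γ X
  subst σ (var x)     = σ x
  subst σ (node f ts) = node f (substs σ ts)

  substs : (X → Term Γ X) → List (Term Γ X) → List (Term Γ X)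
  substs σ []       = []
  substs σ (t ∷ ts) = subst σ t ∷ substs σ ts

mutual
  mapSymbols : (Γ → Δ) → Term Γ X → Term Δ X
  mapSymbols φ (var x)     = var x
  mapSymbols φ (node f ts) = node (φ f) (mapSymbols* φ ts)

  mapSymbols* : (Γ → Δ) → List (Term Γ X) → List (Term Δ X)
  mapSymbols* φ []       = []
  mapSymbols* φ (t ∷ ts) = mapSymbols φ t ∷ mapSymbols* φ ts

data Context (Γ : Set a) (X : Set b) : Set (a ⊔ b) where
  □    : Context Γ X
  node : Γ → List (Term Γ X) → Context Γ X → List (Term Γ X) → Context Γ X

plug : Context Γ X → Term Γ X → Term Γ X
plug □                t = t
plug (node f us C ws) t = node f (us ++ plug C t ∷ ws)

TRS : Set a → Set b → (r : Level) → Set _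
TRS Γ X r = Rel (Term Γ X) r

data Rewrite {Γ : Set a} {X : Set b} (R : TRS Γ X r) : Rel (Term Γ X) (a ⊔ b ⊔ r) where
  rewr : ∀ (C : Context Γ X) (σ : X → Term Γ X) {lhs rhs} → R lhs rhs →
         Rewrite R (plug C (subst σ lhs)) (plug C (subst σ rhs))

data Swap {Γ : Set a} {X : Set b} : TRS Γ X (a ⊔ b) where
  swap : ∀ f us x y ws → Unique (us ++ x ∷ y ∷ ws) →
         Swap (node f (vars (us ++ x ∷ y ∷ ws))) (node f (vars (us ++ y ∷ x ∷ ws)))

-- Trees are terms up to _≃_: there is no quotient type, so a tree is
-- represented by any of its terms, and relations on trees by
-- ≃-invariant relations on terms.
infix 4 _≃_
_≃_ : {Γ : Set a} {X : Set b} → Rel (Term Γ X) (a ⊔ b)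
_≃_ = EqClosure (Rewrite Swap)

-- [s] → [t] iff some representatives of the two classes are related.
OnTrees : {Γ : Set a} {X : Set b} → Rel (Term Γ X) r → Rel (Term Γ X) (a ⊔ b ⊔ r)
OnTrees _⟶_ s t = ∃₂ λ s′ t′ → s ≃ s′ × s′ ⟶ t′ × t′ ≃ t

-- The disjoint union of Sig and its starred copy.
data WithStars (Sig : Set a) : Set a where
  plain : Sig → WithStars Sig
  _⋆    : Sig → WithStars Sig

-- The inclusion of star-free terms; it preserves _≃_, hence acts on trees.
starFree : Term Sig X → Term (WithStars Sig) X
starFree = mapSymbols plain

data Star {Sig : Set a} (X : Set b) (_>_ : Rel Sig r) :
          TRS (WithStars Sig) X (a ⊔ b ⊔ r) where

  put : ∀ f xs → Unique xs →
    Star X _>_ (node (plain f) (vars xs)) (node (f ⋆) (vars xs))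

  select : ∀ f xs y zs → Unique (xs ++ y ∷ zs) →
    Star X _>_ (node (f ⋆) (vars (xs ++ y ∷ zs))) (var y)

  copy : ∀ f g xs n → Unique xs → f > g →
    Star X _>_ (node (f ⋆) (vars xs))
               (node (plain g) (replicate n (node (f ⋆) (vars xs))))

  down : ∀ f g xs ys zs n → Unique (xs ++ ys ++ zs) →
    Star X _>_ (node (f ⋆) (vars xs ++ node (plain g) (vars ys) ∷ vars zs))
               (node (plain f) (vars xs ++ replicate n (node (g ⋆) (vars ys)) ++ vars zs))

StarStep : {Sig : Set a} (X : Set b) → Rel Sig r → Rel (Term (WithStars Sig) X) (a ⊔ b ⊔ r)
StarStep X _>_ = OnTrees (Rewrite (Star X _>_))

{-# OPTIONS --safe #-}
module Submission where

-- Attach to every star a budget: a natural number bounding how often the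
-- starred symbol may still be copied. With budgets, rewriting is
-- terminating (`⟶-wellFounded`), although Star itself is not: the copies
-- f⋆(…) made by (copy) carry a strictly smaller budget. Termination holds
-- because every labelled step out of a node f(t₁,…,tₙ), with the tᵢ already
-- known to be accessible, either selects some tᵢ or yields accessible
-- arguments and decreases lexicographically: first the symbol, in the
-- well-founded order; then the arguments, where one tᵢ is replaced by
-- finitely many of its reducts, as in the multiset order; and last the
-- label, in which an unstarred symbol counts as ω and a starred one as its
-- budget. In the case of (copy) the arguments of the result are accessible
-- because their budget is smaller.
--
-- A finite reduction of k steps on trees lifts to labelled terms, provided
-- that all budgets at its start are at least k (`lift-reduction`): each
-- (put) chooses a budget as large as the number of steps that remain. A
-- star-free tree has no budgets, so any reduction from it can be lifted.
--
-- If t ⇝⁺ t for a star-free t, then a labelled version of t reduces in at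
-- least one step to a labelled version of t, where the cycle can be lifted
-- again, and so on forever. This contradicts termination.
--
-- Labelled terms are ordered; the passage to trees is confined to the
-- relation between labelled terms and the terms they label, which holds up
-- to permutation of arguments at every node and hence is invariant under ≃.

open import Defs
open import Level using (Level; _⊔_)
open import Function.Base using (flip)
open import Induction.WellFounded using (Acc; acc; acc-inverse; WellFounded)
open import Relation.Binary.Core using (Rel)
open import Relation.Binary.Structures using (IsStrictPartialOrder)
open import Relation.Binary.PropositionalEquality.Core using (_≡_; refl; trans; cong)
open import Relation.Binary.Construct.Closure.Transitive using (TransClosure; [_]; _∷_)
open import Relation.Binary.Construct.Closure.ReflexiveTransitive using (ε; _◅_)
open import Relation.Binary.Construct.Closure.Symmetric using (fwd; bwd)
open import Relation.Nullary.Negation.Core using (¬_)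
open import Data.List.Base using (List; []; _∷_; _++_; replicate)
open import Data.List.Properties using (map-++)
open import Data.List.Membership.Propositional using (_∈_)
open import Data.List.Membership.Propositional.Properties using (∈-∃++; ∈-insert)
open import Data.List.Relation.Binary.Permutation.Propositional using (_↭_; ↭-refl; ↭-sym; ↭-trans; ↭-swap)
open import Data.List.Relation.Binary.Permutation.Propositional.Properties using (∈-resp-↭; drop-mid; shifts; ++⁺ˡ)
open import Data.List.Relation.Binary.Pointwise using (Pointwise; []; _∷_)
import Data.List.Relation.Binary.Pointwise as Pointwise
open import Data.List.Relation.Unary.All using (All; []; _∷_)
import Data.List.Relation.Unary.All as All
import Data.List.Relation.Unary.All.Properties as All
open import Data.Nat.Base using (ℕ; zero; suc; _≤_; s≤s)
open import Data.Nat.Properties using (≤-refl; ≤-trans; n≤1+n)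
open import Data.Product.Base using (∃; ∃₂; _×_; _,_)

private variable
  a b r ℓ : Level
  A Sig X : Set a

accessible⁺ : ∀ {A : Set a} {R : Rel A ℓ} {x} →
              Acc (flip R) x → Acc (flip (TransClosure R)) x
accessible⁺ (acc rec) = acc λ where
  [ Rxy ]      → accessible⁺ (rec Rxy)
  (Rxy ∷ R⁺yz) → acc-inverse (accessible⁺ (rec Rxy)) R⁺yz

-- Replacing one element of a list by several smaller ones

-- One step of the multiset extension of R, on lists and in place: a single
-- element x is replaced by finitely many elements y with R x y.
data Replace {A : Set a} (R : Rel A ℓ) : Rel (List A) (a ⊔ ℓ) where
  here  : ∀ {x xs ys} → All (R x) ys → Replace R (x ∷ xs) (ys ++ xs)
  there : ∀ {x xs ys} → Replace R xs ys → Replace R (x ∷ xs) (x ∷ ys)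

module _ {A : Set a} {R : Rel A ℓ} where

  replace-at : ∀ xs {x ys zs} → All (R x) ys →
               Replace R (xs ++ x ∷ zs) (xs ++ ys ++ zs)
  replace-at []       Rxys = here Rxys
  replace-at (_ ∷ xs) Rxys = there (replace-at xs Rxys)

  -- The smaller elements are written R x y, so accessibility is that of the
  -- converse relation.
  private
    SN  : A → Set _
    SN  = Acc (flip R)
    SN* : List A → Set _
    SN* = Acc (flip (Replace R))

  All-SN-Replace : ∀ {xs ys} → Replace R xs ys → All SN xs → All SN ys
  All-SN-Replace (here Rxys) (acc x ∷ xs) = All.++⁺ (All.map x Rxys) xs
  All-SN-Replace (there R*)  (x ∷ xs)     = x ∷ All-SN-Replace R* xs

  private mutual
    SN*-∷ : ∀ {x xs} → SN x → SN* xs → SN* (x ∷ xs)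
    SN*-∷ {x} {xs} sx sxs = acc (SN*-∷-reducts sx sxs)

    SN*-∷-reducts : ∀ {x xs ys} → SN x → SN* xs → Replace R (x ∷ xs) ys → SN* ys
    SN*-∷-reducts (acc rx) sxs       (here Rxys) = SN*-++ rx Rxys sxs
    SN*-∷-reducts sx       (acc rxs) (there R*)  = SN*-∷ sx (rxs R*)

    SN*-++ : ∀ {x xs ys} → (∀ {y} → R x y → SN y) → All (R x) ys → SN* xs → SN* (ys ++ xs)
    SN*-++ rx []           sxs = sxs
    SN*-++ rx (Rxy ∷ Rxys) sxs = SN*-∷ (rx Rxy) (SN*-++ rx Rxys sxs)

  -- Well-foundedness of the multiset extension, on lists of accessible
  -- elements.
  All-SN⇒SN* : ∀ {xs} → All SN xs → SN* xs
  All-SN⇒SN* []       = acc λ ()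
  All-SN⇒SN* (x ∷ xs) = SN*-∷ x (All-SN⇒SN* xs)

-- Labelled terms and their termination

-- Symbols in which each star carries a budget: f ^ω labels the unstarred
-- symbol f, and f ^ n labels f⋆ with budget n.
data Labelled (Sig : Set a) : Set a where
  _^ω : Sig → Labelled Sig
  _^_ : Sig → ℕ → Labelled Sig

-- The symbol that is labelled.
base : Labelled Sig → Sig
base (f ^ω)  = f
base (f ^ n) = f

LTerm : Set a → Set b → Set (a ⊔ b)
LTerm Sig X = Term (Labelled Sig) X

-- Labelled rewriting. Besides put, select and copy, there is a single rule
-- `args` that replaces one argument by finitely many of its one-step reducts
-- and relabels the root at will; it comprises (down), whose new arguments
-- arise by put, and rewriting below the root.
data Step {Sig : Set a} {X : Set b} (_>_ : Rel Sig r) : Rel (LTerm Sig X) (a ⊔ b ⊔ r) where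
  put    : ∀ {f n ts} → Step _>_ (node (f ^ω) ts) (node (f ^ n) ts)
  select : ∀ {f n ts t} → t ∈ ts → Step _>_ (node (f ^ n) ts) t
  copy   : ∀ {f g n ts} m → f > g →
           Step _>_ (node (f ^ suc n) ts) (node (g ^ω) (replicate m (node (f ^ n) ts)))
  args   : ∀ {φ ψ ts us} → base φ ≡ base ψ → Replace (Step _>_) ts us →
           Step _>_ (node φ ts) (node ψ us)

module Termination {Sig : Set a} (X : Set b) (_>_ : Rel Sig r) (>-wf : WellFounded (flip _>_)) where

  private
    _⟶_ : Rel (LTerm Sig X) _
    _⟶_ = Step _>_

    SN : LTerm Sig X → Set _
    SN = Acc (flip _⟶_)

    SN* : List (LTerm Sig X) → Set _
    SN* = Acc (flip (Replace _⟶_))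

  -- The recursion is on the accessibility of f, then on that of
  -- ts, and then on the label, where SN-^ω precedes SN-^ n.
  private mutual
    SN-node : ∀ φ {ts} → Acc (flip _>_) (base φ) → SN* ts → All SN ts → SN (node φ ts)
    SN-node (f ^ω)  f↓ ts↓ ts = SN-^ω f↓ ts↓ ts
    SN-node (f ^ n) f↓ ts↓ ts = SN-^ n f↓ ts↓ ts

    SN-^ω : ∀ {f ts} → Acc (flip _>_) f → SN* ts → All SN ts → SN (node (f ^ω) ts)
    SN-^ω f↓ ts↓ ts = acc (SN-^ω-reducts f↓ ts↓ ts)

    SN-^ω-reducts : ∀ {f ts u} → Acc (flip _>_) f → SN* ts → All SN ts →
                    node (f ^ω) ts ⟶ u → SN u
    SN-^ω-reducts f↓ ts↓ ts (put {n = n})    = SN-^ n f↓ ts↓ ts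
    SN-^ω-reducts f↓ ts↓ ts (args f≡base R*) = SN-args f≡base f↓ ts↓ ts R*

    SN-^ : ∀ n {f ts} → Acc (flip _>_) f → SN* ts → All SN ts → SN (node (f ^ n) ts)
    SN-^ n f↓ ts↓ ts = acc (SN-^-reducts n f↓ ts↓ ts)

    SN-^-reducts : ∀ n {f ts u} → Acc (flip _>_) f → SN* ts → All SN ts →
                   node (f ^ n) ts ⟶ u → SN u
    SN-^-reducts n       f↓ ts↓ ts (select t∈ts)         = All.lookup ts t∈ts
    SN-^-reducts (suc n) f↓@(acc below) ts↓ ts (copy m f>g) =
      let copies = All.replicate⁺ m (SN-^ n f↓ ts↓ ts)
      in  SN-^ω (below f>g) (All-SN⇒SN* copies) copies
    SN-^-reducts n       f↓ ts↓ ts (args f≡base R*)      = SN-args f≡base f↓ ts↓ ts R*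

    SN-args : ∀ {f ψ ts us} → f ≡ base ψ → Acc (flip _>_) f → SN* ts → All SN ts →
              Replace _⟶_ ts us → SN (node ψ us)
    SN-args {ψ = ψ} refl f↓ (acc ts↓) ts R* = SN-node ψ f↓ (ts↓ R*) (All-SN-Replace R* ts)

  mutual
    ⟶-wellFounded : WellFounded (flip _⟶_)
    ⟶-wellFounded (var x)     = acc λ ()
    ⟶-wellFounded (node φ ts) = SN-node φ (>-wf (base φ)) (All-SN⇒SN* (all-SN ts)) (all-SN ts)

    all-SN : ∀ ts → All SN ts
    all-SN []       = []
    all-SN (t ∷ ts) = ⟶-wellFounded t ∷ all-SN ts

-- Labellings of trees

-- Labels k φ h: φ labels h, with a budget of at least k if h is starred.
data Labels {Sig : Set a} (k : ℕ) : Labelled Sig → WithStars Sig → Set a where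
  plain : ∀ {f} → Labels k (f ^ω) (plain f)
  star  : ∀ {f n} → k ≤ n → Labels k (f ^ n) (f ⋆)

-- k ⊢ l ∼ s: the tree of l is that of s with budgets of at least k attached
-- to all stars. The children of each node are matched up to a permutation,
-- so that s matters only up to ≃.
infix 4 _⊢_∼_
data _⊢_∼_ {Sig : Set a} {X : Set b} (k : ℕ) : LTerm Sig X → Term (WithStars Sig) X → Set (a ⊔ b) where
  var  : ∀ {x} → k ⊢ var x ∼ var x
  node : ∀ {φ h ls ls′ ss} → Labels k φ h → ls ↭ ls′ → Pointwise (k ⊢_∼_) ls′ ss →
         k ⊢ node φ ls ∼ node h ss

weaken-Labels : ∀ {j k φ} {h : WithStars Sig} → j ≤ k → Labels k φ h → Labels j φ h
weaken-Labels j≤k plain      = plain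
weaken-Labels j≤k (star k≤n) = star (≤-trans j≤k k≤n)

mutual
  weaken : ∀ {j k} {l : LTerm Sig X} {s} → j ≤ k → k ⊢ l ∼ s → j ⊢ l ∼ s
  weaken j≤k var           = var
  weaken j≤k (node φ p ls) = node (weaken-Labels j≤k φ) p (weaken* j≤k ls)

  weaken* : ∀ {j k} {ls : List (LTerm Sig X)} {ss} → j ≤ k →
            Pointwise (k ⊢_∼_) ls ss → Pointwise (j ⊢_∼_) ls ss
  weaken* j≤k []       = []
  weaken* j≤k (l ∷ ls) = weaken j≤k l ∷ weaken* j≤k ls

-- The labelled version of a star-free term.
label : Term Sig X → LTerm Sig X
label = mapSymbols _^ω

mutual
  label-∼ : ∀ k (t : Term Sig X) → k ⊢ label t ∼ starFree t
  label-∼ k (var x)     = var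
  label-∼ k (node f ts) = node plain ↭-refl (label-∼* k ts)

  label-∼* : ∀ k (ts : List (Term Sig X)) →
             Pointwise (k ⊢_∼_) (mapSymbols* _^ω ts) (mapSymbols* plain ts)
  label-∼* k []       = []
  label-∼* k (t ∷ ts) = label-∼ k t ∷ label-∼* k ts

-- Without stars there are no budgets to bound, so k is irrelevant. This is
-- what allows the lifting of a cycle to be repeated.
mutual
  ∼-starFree : ∀ {j} k (t : Term Sig X) {l} → j ⊢ l ∼ starFree t → k ⊢ l ∼ starFree t
  ∼-starFree k (var x)     var               = var
  ∼-starFree k (node f ts) (node plain p ls) = node plain p (∼-starFree* k ts ls)

  ∼-starFree* : ∀ {j} k (ts : List (Term Sig X)) {ls} →
                Pointwise (j ⊢_∼_) ls (mapSymbols* plain ts) →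
                Pointwise (k ⊢_∼_) ls (mapSymbols* plain ts)
  ∼-starFree* k []       []       = []
  ∼-starFree* k (t ∷ ts) (l ∷ ls) = ∼-starFree k t l ∷ ∼-starFree* k ts ls

split : ∀ {A : Set a} {B : Set b} {R : A → B → Set ℓ} us {s ws ls} →
        Pointwise R ls (us ++ s ∷ ws) →
        ∃₂ λ as m → ∃ λ bs → ls ≡ as ++ m ∷ bs × Pointwise R as us × R m s × Pointwise R bs ws
split []       (r ∷ rs) = [] , _ , _ , refl , [] , r , rs
split (u ∷ us) (r ∷ rs) with split us rs
... | as , m , bs , refl , ras , rm , rbs = _ ∷ as , m , bs , refl , r ∷ ras , rm , rbs

↭-split : ∀ {A : Set a} {ls : List A} as {m bs} → ls ↭ as ++ m ∷ bs →
          ∃₂ λ ps qs → ls ≡ ps ++ m ∷ qs × ps ++ qs ↭ as ++ bs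
↭-split as p with ∈-∃++ (∈-resp-↭ (↭-sym p) (∈-insert as))
... | ps , qs , refl = ps , qs , refl , drop-mid ps as p

↭-insert : ∀ {A : Set a} {ps qs as bs : List A} ms → ps ++ qs ↭ as ++ bs →
           ps ++ ms ++ qs ↭ as ++ ms ++ bs
↭-insert {ps = ps} {as = as} ms p =
  ↭-trans (shifts ps ms) (↭-trans (++⁺ˡ ms p) (shifts ms as))

-- A view of the children ls of a node that labels one with the children
-- us ++ s ∷ ws: the child `this` labels s, and may be exchanged for labelled
-- versions ms of any list ts that takes the place of s. The exchange may also
-- lower the bound on the budgets, and change the symbol of the node.
record Child {Sig : Set a} {X : Set b} k (ls : List (LTerm Sig X)) us s ws : Set (a ⊔ b) where
  constructor child
  field
    {before after} : List (LTerm Sig X)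
    {this}         : LTerm Sig X
    position       : ls ≡ before ++ this ∷ after
    matches        : k ⊢ this ∼ s
    exchange       : ∀ {j φ h ms ts} → j ≤ k → Labels j φ h → Pointwise (j ⊢_∼_) ms ts →
                     j ⊢ node φ (before ++ ms ++ after) ∼ node h (us ++ ts ++ ws)

child-at : ∀ {k φ h} {ls : List (LTerm Sig X)} us {s ws} →
           k ⊢ node φ ls ∼ node h (us ++ s ∷ ws) → Child k ls us s ws
child-at us (node _ p pw) with split us pw
... | as , m , bs , refl , ras , rm , rbs with ↭-split as p
... | ps , qs , refl , p′ =
  child refl rm λ {_} {_} {_} {ms} j≤k φ rms →
    node φ (↭-insert {ps = ps} {as = as} ms p′)
      (Pointwise.++⁺ (weaken* j≤k ras) (Pointwise.++⁺ rms (weaken* j≤k rbs)))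

-- Invariance under ≃

substs-++ : (σ : X → Term A X) → ∀ ts us → substs σ (ts ++ us) ≡ substs σ ts ++ substs σ us
substs-++ σ []       us = refl
substs-++ σ (t ∷ ts) us = cong (_ ∷_) (substs-++ σ ts us)

substs-replicate : (σ : X → Term A X) → ∀ n t → substs σ (replicate n t) ≡ replicate n (subst σ t)
substs-replicate σ zero    t = refl
substs-replicate σ (suc n) t = cong (_ ∷_) (substs-replicate σ n t)

substs-vars-++ : (σ : X → Term A X) → ∀ xs ys →
                 substs σ (vars (xs ++ ys)) ≡ substs σ (vars xs) ++ substs σ (vars ys)
substs-vars-++ σ xs ys = trans (cong (substs σ) (map-++ var xs ys)) (substs-++ σ (vars xs) (vars ys))

∼-swap : ∀ {k h} {l : LTerm Sig X} us {x y ws} →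
         k ⊢ l ∼ node h (us ++ x ∷ y ∷ ws) → k ⊢ l ∼ node h (us ++ y ∷ x ∷ ws)
∼-swap us (node f p pw) with split us pw
... | as , m , n ∷ bs , refl , ras , rm , rn ∷ rbs =
  node f (↭-trans p (++⁺ˡ as (↭-swap m n ↭-refl))) (Pointwise.++⁺ ras (rn ∷ rm ∷ rbs))

∼-plug : ∀ {k} {s t : Term (WithStars Sig) X} → (∀ {l} → k ⊢ l ∼ s → k ⊢ l ∼ t) →
         ∀ C {l} → k ⊢ l ∼ plug C s → k ⊢ l ∼ plug C t
∼-plug s⇒t □                l∼s           = s⇒t l∼s
∼-plug s⇒t (node f us C ws) (node φ p pw) with split us pw
... | as , m , bs , refl , ras , rm , rbs =
  node φ p (Pointwise.++⁺ ras (∼-plug s⇒t C rm ∷ rbs))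

-- The rule Swap and its converse are both of this form.
∼-swap-vars : ∀ {k h} {l : LTerm Sig X} σ us {x y ws} →
              k ⊢ l ∼ subst σ (node h (vars (us ++ x ∷ y ∷ ws))) →
              k ⊢ l ∼ subst σ (node h (vars (us ++ y ∷ x ∷ ws)))
∼-swap-vars σ us {x} {y} {ws}
  rewrite substs-vars-++ σ us (x ∷ y ∷ ws) | substs-vars-++ σ us (y ∷ x ∷ ws)
  = ∼-swap (substs σ (vars us))

∼-resp-≃ : ∀ {k} {l : LTerm Sig X} {s t} → s ≃ t → k ⊢ l ∼ s → k ⊢ l ∼ t
∼-resp-≃ ε l∼s = l∼s
∼-resp-≃ (fwd (rewr C σ (swap f us x y ws _)) ◅ s≃t) l∼s =
  ∼-resp-≃ s≃t (∼-plug (∼-swap-vars σ us) C l∼s)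
∼-resp-≃ (bwd (rewr C σ (swap f us x y ws _)) ◅ s≃t) l∼s =
  ∼-resp-≃ s≃t (∼-plug (∼-swap-vars σ us) C l∼s)

-- Lifting reductions to labelled terms

module Lifting {Sig : Set a} {X : Set b} (_>_ : Rel Sig r) where

  private
    _⟶_ : Rel (LTerm Sig X) _
    _⟶_ = Step _>_

  -- A step from s to t can be imitated on every labelled version of s that
  -- has one unit of budget more than t is to have.
  Lifts : Rel (Term (WithStars Sig) X) _
  Lifts s t = ∀ {k l} → suc k ⊢ l ∼ s → ∃ λ m → l ⟶ m × k ⊢ m ∼ t

  lift-plug : ∀ {s t} → Lifts s t → ∀ C → Lifts (plug C s) (plug C t)
  lift-plug lift □                l∼s = lift l∼s
  lift-plug lift (node h us C ws) l∼s@(node φ _ _) with child-at us l∼s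
  ... | child {before = before} refl this exchange with lift-plug lift C this
  ... | m , step , m∼ =
    _ , args refl (replace-at before (step ∷ [])) ,
    exchange (n≤1+n _) (weaken-Labels (n≤1+n _) φ) (m∼ ∷ [])

  lift-select : ∀ {f} us {s ws} → Lifts (node (f ⋆) (us ++ s ∷ ws)) s
  lift-select us l∼s@(node (star _) _ _) with child-at us l∼s
  ... | child {before = before} refl this _ =
    _ , select (∈-insert before) , weaken (n≤1+n _) this

  lift-copy : ∀ {f g} n {ss} → f > g →
              Lifts (node (f ⋆) ss) (node (plain g) (replicate n (node (f ⋆) ss)))
  lift-copy n f>g (node (star (s≤s k≤m)) p ls) =
    _ , copy n f>g ,
    node plain ↭-refl (Pointwise.replicate⁺ (node (star k≤m) p (weaken* (n≤1+n _) ls)) n)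

  lift-down : ∀ {f g} n us {ss ws} →
              Lifts (node (f ⋆) (us ++ node (plain g) ss ∷ ws))
                    (node (plain f) (us ++ replicate n (node (g ⋆) ss) ++ ws))
  lift-down n us {k = k} l∼s@(node (star _) _ _) with child-at us l∼s
  ... | child {before = before} refl (node {ls = ls} plain p ms) exchange =
    _ , args refl (replace-at before (All.replicate⁺ n put)) ,
    exchange (n≤1+n _) plain
      (Pointwise.replicate⁺ (node (star (≤-refl {k})) p (weaken* (n≤1+n _) ms)) n)

  lift-rule : ∀ {s t} → Star X _>_ s t → ∀ σ → Lifts (subst σ s) (subst σ t)
  lift-rule (put f xs _) σ {k} (node plain p ls) =
    _ , put , node (star (≤-refl {k})) p (weaken* (n≤1+n _) ls)
  lift-rule (select f xs y zs _) σ
    rewrite substs-vars-++ σ xs (y ∷ zs)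
    = lift-select (substs σ (vars xs))
  lift-rule (copy f g xs n _ f>g) σ
    rewrite substs-replicate σ n (node (f ⋆) (vars xs))
    = lift-copy n f>g
  lift-rule (down f g xs ys zs n _) σ
    rewrite substs-++ σ (vars xs) (node (plain g) (vars ys) ∷ vars zs)
          | substs-++ σ (vars xs) (replicate n (node (g ⋆) (vars ys)) ++ vars zs)
          | substs-++ σ (replicate n (node (g ⋆) (vars ys))) (vars zs)
          | substs-replicate σ n (node (g ⋆) (vars ys))
    = lift-down n (substs σ (vars xs))

  lift-step : ∀ {s t} → StarStep X _>_ s t → Lifts s t
  lift-step (_ , _ , s≃s′ , rewr C σ rule , t′≃t) l∼s
    with lift-plug (lift-rule rule σ) C (∼-resp-≃ s≃s′ l∼s)
  ... | m , step , m∼t′ = m , step , ∼-resp-≃ t′≃t m∼t′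

  -- The witness for k is the length of the reduction.
  lift-reduction : ∀ {s t} → TransClosure (StarStep X _>_) s t →
                   ∃ λ k → ∀ {l} → k ⊢ l ∼ s → ∃ λ m → TransClosure _⟶_ l m × 0 ⊢ m ∼ t
  lift-reduction [ step ] = 1 , λ l∼s →
    let m , l⟶m , m∼t = lift-step step l∼s in m , [ l⟶m ] , m∼t
  lift-reduction (step ∷ steps) with lift-reduction steps
  ... | k , lift = suc k , λ l∼s →
    let m , l⟶m , m∼u  = lift-step step l∼s
        n , m⟶⁺n , n∼t = lift m∼u
    in  n , l⟶m ∷ m⟶⁺n , n∼t

  -- By induction on l: lifting the cycle leads to a reduct of l that again
  -- labels t.
  no-cycle : ∀ {l} → Acc (flip (TransClosure _⟶_)) l → (t : Term Sig X) → 0 ⊢ l ∼ starFree t →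
             ¬ TransClosure (StarStep X _>_) (starFree t) (starFree t)
  no-cycle (acc rec) t l∼t t⇝⁺t with lift-reduction t⇝⁺t
  ... | k , lift with lift (∼-starFree k t l∼t)
  ... | m , l⟶⁺m , m∼t = no-cycle (rec l⟶⁺m) t m∼t t⇝⁺t

corollary4p19 : ∀ {a b r : Level} (Sig : Set a) (X : Set b) → Infinite X →
    (_>_ : Rel Sig r) → IsStrictPartialOrder _≡_ _>_ → WellFounded (flip _>_) →
    (t : Term Sig X) → ¬ TransClosure (StarStep X _>_) (starFree t) (starFree t)
corollary4p19 Sig X _ _>_ _ >-wf t =
  no-cycle (accessible⁺ (⟶-wellFounded (label t))) t (label-∼ 0 t)
  where
  open Termination X _>_ >-wf
  open Lifting _>_
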